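{- Let $n \ge 3$ be a fixed integer. Then there are only finitely many tuples $(a_1,\ldots,a_n,d) \in \mathbb{N}^{n+1}$ with $a_i \mid d$ for $i=1,\ldots,n$ and $\gcd(a_i,a_j)=1$ for $i \neq j$ such that the set $L_n = L_{a_1,\ldots,a_n,d,n}$ of solutions $(x_1,\ldots,x_n)\in\mathbb{N}^n$ of $$a_1x_1^2+\cdots+a_nx_n^2 = d\,x_1\cdots x_n$$ is non-empty. Moreover, for every such tuple with $L_n \ne \emptyset$, the set $F_n$ of fundamental solutions of this equation is finite.
   Context: $\mathbb{N}$ denotes the positive integers. For $n\ge 3$ and $a_1,\ldots,a_n,d\in\mathbb{N}$ with $a_i\mid d$ for all $i$ and $\gcd(a_i,a_j)=1$ for $i\ne j$, let $L_n=L_{a_1,\ldots,a_n,d,n}$ be the set of $(x_1,\ldots,x_n)\in\mathbb{N}^n$ with $a_1x_1^2+\cdots+a_nx_n^2=d\,x_1\cdots x_n$. For $i=1,\ldots,n$ let $\psi_i:L_n\to L_n$ be the permutation replacing the $i$-th coordinate $x_i$ by $x_i'=\frac{d}{a_i}\prod_{j\ne i}x_j-x_i$ and fixing the other coordinates. The height of $\overline{x}=(x_1,\ldots,x_n)\in L_n$ is $h(\overline{x})=x_1+\cdots+x_n$. An element $\overline{x}\in L_n$ is called a fundamental solution if $h(\psi_i(\overline{x}))\ge h(\overline{x})$ for all $i=1,\ldots,n$. $F_n$ denotes the set of fundamental solutions. -}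

module Defs where

open import Data.Fin using (Fin; zero; suc)
open import Data.Fin.Properties using () renaming (_≟_ to _≟ᶠ_)
open import Data.List using (List)
open import Data.List.Membership.Propositional using (_∈_)
open import Data.Nat hiding (_⊔_)
open import Data.Nat.Divisibility using (_∣_; divides; quotient)
open import Data.Nat.GCD using (gcd)
open import Data.Nat.Properties
open import Data.Nat.Tactic.RingSolver using (solve-∀)
open import Data.Product using (∃; _×_; _,_)
open import Data.Vec using (Vec; []; _∷_; lookup; sum; foldr′; zipWith; removeAt; _[_]≔_)
open import Data.Vec.Properties
  using (lookup∘update; lookup∘update′; []≔-idempotent; []≔-lookup)
open import Function using (_⇔_)
open import Level using (Level; _⊔_)
open import Relation.Binary.PropositionalEquality
open import Relation.Nullary using (yes; no)
open import Relation.Unary using (Pred)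

private variable
  α ℓ : Level
  n   : ℕ

-- The list may repeat elements, but contains nothing outside P.
IsFinite : {A : Set α} → Pred A ℓ → Set (α ⊔ ℓ)
IsFinite {A = A} P = ∃ λ (xs : List A) → ∀ x → P x ⇔ x ∈ xs

-- The tuples are of positive integers, whereas ℕ contains 0.
Positive : Vec ℕ n → Set
Positive x = ∀ i → 0 < lookup x i

product : Vec ℕ n → ℕ
product = foldr′ _*_ 1

-- ∏_{j ≠ i} x_j
productExcept : Vec ℕ n → Fin n → ℕ
productExcept {n = suc _} x i = product (removeAt x i)

weightedSquares : Vec ℕ n → Vec ℕ n → ℕ
weightedSquares a x = sum (zipWith (λ aᵢ xᵢ → aᵢ * xᵢ ^ 2) a x)

record Admissible (a : Vec ℕ n) (d : ℕ) : Set where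
  field
    a-positive : Positive a
    d-positive : 0 < d
    aᵢ∣d       : ∀ i → lookup a i ∣ d
    coprime    : ∀ i j → i ≢ j → gcd (lookup a i) (lookup a j) ≡ 1

record Solution (a : Vec ℕ n) (d : ℕ) (x : Vec ℕ n) : Set where
  field
    positive : Positive x
    equation : weightedSquares a x ≡ d * product x

height : Vec ℕ n → ℕ
height = sum

module _ {a : Vec ℕ n} {d : ℕ} (adm : Admissible a d) where
  open Admissible adm

  -- The quotient is d / aᵢ.  On the set Lₙ of solutions the subtraction is never
  -- truncated (ψ-untruncated), and ψ i is an involution of Lₙ (ψ-solution,
  -- ψ-involutive).
  ψ : Fin n → Vec ℕ n → Vec ℕ n
  ψ i x = x [ i ]≔ (quotient (aᵢ∣d i) * productExcept x i ∸ lookup x i)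

  record Fundamental (x : Vec ℕ n) : Set where
    field
      solution : Solution a d x
      minimal  : ∀ i → height x ≤ height (ψ i x)

private
  product-split : (x : Vec ℕ n) (i : Fin n) →
                  product x ≡ lookup x i * productExcept x i
  product-split (x ∷ xs)         zero    = refl
  product-split (x ∷ xs@(_ ∷ _)) (suc i) =
    trans (cong (x *_) (product-split xs i)) (swap x (lookup xs i) _)
    where
    swap : ∀ p q r → p * (q * r) ≡ q * (p * r)
    swap = solve-∀

  removeAt-update : (x : Vec ℕ (suc n)) (i : Fin (suc n)) (y : ℕ) →
                    removeAt (x [ i ]≔ y) i ≡ removeAt x i
  removeAt-update (x ∷ xs)         zero    y = refl
  removeAt-update (x ∷ xs@(z ∷ zs)) (suc i) y = go i
    where
    go : ∀ i → removeAt ((x ∷ xs) [ suc i ]≔ y) (suc i) ≡ removeAt (x ∷ xs) (suc i)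
    go zero    = refl
    go (suc i) = cong (x ∷_) (removeAt-update xs (suc i) y)

  productExcept-update : (x : Vec ℕ n) (i : Fin n) (y : ℕ) →
                         productExcept (x [ i ]≔ y) i ≡ productExcept x i
  productExcept-update {n = suc _} x i y = cong product (removeAt-update x i y)

  weightedSquares-update :
    (a x : Vec ℕ n) (i : Fin n) (y : ℕ) →
    weightedSquares a (x [ i ]≔ y) + lookup a i * lookup x i ^ 2 ≡
    weightedSquares a x + lookup a i * y ^ 2
  weightedSquares-update (a ∷ as) (x ∷ xs) zero y =
    comm (a * y ^ 2) (weightedSquares as xs) (a * x ^ 2)
    where
    comm : ∀ p q r → p + q + r ≡ r + q + p
    comm = solve-∀
  weightedSquares-update (a ∷ as) (x ∷ xs) (suc i) y =
    trans (+-assoc (a * x ^ 2) _ _)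
      (trans (cong (a * x ^ 2 +_) (weightedSquares-update as xs i y))
        (sym (+-assoc (a * x ^ 2) _ _)))

  term-positive : ∀ {p q} → 0 < p → 0 < q → 0 < p * q ^ 2
  term-positive {p} {q} 0<p 0<q =
    *-mono-≤ 0<p (*-mono-≤ 0<q (*-mono-≤ 0<q (≤-refl {1})))

  term≤ : (a x : Vec ℕ n) (i : Fin n) →
          lookup a i * lookup x i ^ 2 ≤ weightedSquares a x
  term≤ (a ∷ as) (x ∷ xs) zero    = m≤m+n _ _
  term≤ (a ∷ as) (x ∷ xs) (suc i) = m≤n⇒m≤o+n _ (term≤ as xs i)

  term< : 2 ≤ n → (a x : Vec ℕ n) → Positive a → Positive x → (i : Fin n) →
          lookup a i * lookup x i ^ 2 < weightedSquares a x
  term< _ (a ∷ as@(_ ∷ _)) (x ∷ xs) a⁺ x⁺ zero =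
    m<m+n _ (<-≤-trans (term-positive (a⁺ (suc zero)) (x⁺ (suc zero)))
                       (term≤ as xs zero))
  term< _ (a ∷ as) (x ∷ xs) a⁺ x⁺ (suc i) =
    +-mono-≤ (term-positive (a⁺ zero) (x⁺ zero)) (term≤ as xs i)
  term< (s≤s ()) (_ ∷ []) (_ ∷ []) _ _ zero

module _ {a : Vec ℕ n} {d : ℕ} (adm : Admissible a d) {x : Vec ℕ n}
         (sol : Solution a d x) where
  open Admissible adm
  open Solution sol

  private
    factored : ∀ i (y : Vec ℕ n) → d * product y ≡
      lookup a i * lookup y i * (quotient (aᵢ∣d i) * productExcept y i)
    factored i y with aᵢ∣d i
    ... | divides q eq =
      trans (cong₂ _*_ eq (product-split y i))
            (shuffle q (lookup a i) (lookup y i) (productExcept y i))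
      where
      shuffle : ∀ q b y p → q * b * (y * p) ≡ b * y * (q * p)
      shuffle = solve-∀

  ψ-untruncated : 2 ≤ n → ∀ i →
                  lookup x i < quotient (aᵢ∣d i) * productExcept x i
  ψ-untruncated 2≤n i = *-cancelˡ-< (lookup a i * lookup x i) _ _
    (subst₂ _<_ (square (lookup a i) (lookup x i))
                (trans equation (factored i x))
                (term< 2≤n a x a-positive positive i))
    where
    square : ∀ b y → b * (y * (y * 1)) ≡ b * y * y
    square = solve-∀

  ψ-solution : 2 ≤ n → ∀ i → Solution a d (ψ adm i x)
  ψ-solution 2≤n i = record { positive = pos ; equation = eqn }
    where
    Q = quotient (aᵢ∣d i) * productExcept x i
    b = lookup a i
    z = lookup x i
    y = Q ∸ z

    Q≡ : y + z ≡ Q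
    Q≡ = m∸n+n≡m (<⇒≤ (ψ-untruncated 2≤n i))

    pos : Positive (ψ adm i x)
    pos j with j ≟ᶠ i
    ... | yes refl = subst (0 <_) (sym (lookup∘update i x y))
                       (m<n⇒0<n∸m (ψ-untruncated 2≤n i))
    ... | no j≢i   = subst (0 <_) (sym (lookup∘update′ j≢i x y)) (positive j)

    expand : ∀ b y z → b * z * (y + z) + b * (y * (y * 1)) ≡
                       b * y * (y + z) + b * (z * (z * 1))
    expand = solve-∀

    open ≡-Reasoning

    eqn : weightedSquares a (ψ adm i x) ≡ d * product (ψ adm i x)
    eqn = +-cancelʳ-≡ (b * z ^ 2) _ _ (begin
      weightedSquares a (ψ adm i x) + b * z ^ 2
        ≡⟨ weightedSquares-update a x i y ⟩
      weightedSquares a x + b * y ^ 2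
        ≡⟨ cong (_+ b * y ^ 2) (trans equation (factored i x)) ⟩
      b * z * Q + b * y ^ 2
        ≡⟨ cong (λ t → b * z * t + b * y ^ 2) (sym Q≡) ⟩
      b * z * (y + z) + b * y ^ 2
        ≡⟨ expand b y z ⟩
      b * y * (y + z) + b * z ^ 2
        ≡⟨ cong (λ t → b * y * t + b * z ^ 2) Q≡ ⟩
      b * y * Q + b * z ^ 2
        ≡⟨ cong₂ (λ s t → b * s * (quotient (aᵢ∣d i) * t) + b * z ^ 2)
             (sym (lookup∘update i x y)) (sym (productExcept-update x i y)) ⟩
      b * lookup (ψ adm i x) i *
        (quotient (aᵢ∣d i) * productExcept (ψ adm i x) i) + b * z ^ 2
        ≡⟨ cong (_+ b * z ^ 2) (sym (factored i (ψ adm i x))) ⟩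
      d * product (ψ adm i x) + b * z ^ 2 ∎)

  ψ-involutive : 2 ≤ n → ∀ i → ψ adm i (ψ adm i x) ≡ x
  ψ-involutive 2≤n i = begin
    ψ adm i x [ i ]≔ (q * productExcept (ψ adm i x) i ∸ lookup (ψ adm i x) i)
      ≡⟨ cong₂ (λ s t → ψ adm i x [ i ]≔ (q * s ∸ t))
           (productExcept-update x i y) (lookup∘update i x y) ⟩
    ψ adm i x [ i ]≔ (Q ∸ (Q ∸ lookup x i))
      ≡⟨ cong (ψ adm i x [ i ]≔_) (m∸[m∸n]≡n (<⇒≤ (ψ-untruncated 2≤n i))) ⟩
    (x [ i ]≔ y) [ i ]≔ lookup x i
      ≡⟨ []≔-idempotent x i ⟩
    x [ i ]≔ lookup x i
      ≡⟨ []≔-lookup x i ⟩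
    x ∎
    where
    open ≡-Reasoning
    q = quotient (aᵢ∣d i)
    Q = q * productExcept x i
    y = Q ∸ lookup x i

{-# OPTIONS --safe #-}
module Submission where

-- In a fundamental solution each term yᵢ = aᵢ xᵢ² is at most half of S = y₁ + ⋯ + yₙ.  Let q ≥ p be
-- the two largest terms and W the sum of the others, so that q ≤ p + W and S² = O(n² p q).  Squaring
-- the equation gives S² = (d² / a₁⋯aₙ) y₁⋯yₙ, and a₁⋯aₙ ∣ d by coprimality, so d and the other
-- n − 2 coordinates are bounded by a constant depending only on n.  As n ≥ 3 we have W > 0, and then
-- the remaining binary equation p + q + W = K u v bounds p and q too.  Hence d, the aᵢ and all
-- fundamental solutions lie in an explicit finite box; descent on the height turns any solution into
-- a fundamental one, and decidability of all conditions yields the lists.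

open import Defs
open import Data.Fin using (Fin; zero; suc; punchIn; punchOut)
open import Data.Fin.Properties using (all?; any?) renaming (_≟_ to _≟ᶠ_)
open import Data.List using (List; []; _∷_; [_]; filter; upTo; allFin; cartesianProduct; cartesianProductWith)
open import Data.List.Extrema.Nat using (argmax; f[xs]≤f[argmax])
open import Data.List.Membership.Propositional using (_∈_)
open import Data.List.Membership.Propositional.Properties using (∈-filter⁺; ∈-filter⁻; ∈-allFin; ∈-upTo⁺; ∈-cartesianProduct⁺; ∈-cartesianProductWith⁺)
open import Data.List.Relation.Unary.All as All using ()
open import Data.List.Relation.Unary.Any using (here)
open import Data.Nat
open import Data.Nat.Coprimality using (Coprime; coprime-divisor; gcd≡1⇒coprime)
import Data.Nat.Coprimality as Coprimality
open import Data.Nat.Divisibility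
open import Data.Nat.GCD using (gcd)
open import Data.Nat.Induction using (<-wellFounded)
open import Data.Nat.Properties
open import Data.Nat.Tactic.RingSolver using (solve-∀)
open import Data.Product using (∃; _×_; _,_; proj₁; proj₂)
open import Data.Vec using (Vec; []; _∷_; lookup; sum; removeAt; _[_]≔_)
open import Data.Vec.Properties using (removeAt-punchOut)
open import Function using (mk⇔; Equivalence; case_of_)
open import Induction.WellFounded using (Acc; acc)
open import Level using (Level)
open import Relation.Binary.PropositionalEquality hiding ([_])
open import Relation.Nullary using (Dec; yes; no; ¬?; _×-dec_; _→-dec_; map′)
open import Relation.Unary using (Pred; Decidable)

private variable
  ℓ ℓ′ : Level
  A    : Set ℓ
  n    : ℕ

-- Finite predicates, enumeration of boxes, and maxima.

finite-filter : {P : Pred A ℓ} → Decidable P → (xs : List A) →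
                (∀ x → P x → x ∈ xs) → IsFinite P
finite-filter P? xs P⊆xs = filter P? xs , λ x →
  mk⇔ (λ px → ∈-filter⁺ P? (P⊆xs x px) px) (λ x∈ → proj₂ (∈-filter⁻ P? {xs = xs} x∈))

-- The list holds nothing outside `P`, so its head is a witness, and an empty list refutes
-- existence.
finite⇒∃? : {P : Pred A ℓ} → IsFinite P → Dec (∃ P)
finite⇒∃? ([]     , P⇔) = no λ (x , px) → case Equivalence.to (P⇔ x) px of λ ()
finite⇒∃? (x ∷ xs , P⇔) = yes (x , Equivalence.from (P⇔ x) (here refl))

vectorsUpTo : ℕ → ∀ n → List (Vec ℕ n)
vectorsUpTo N zero    = [ [] ]
-- `upTo` excludes its end, so `suc N` admits the entry `N` itself.
vectorsUpTo N (suc n) = cartesianProductWith _∷_ (upTo (suc N)) (vectorsUpTo N n)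

∈-vectorsUpTo : ∀ {N} (x : Vec ℕ n) → (∀ i → lookup x i ≤ N) → x ∈ vectorsUpTo N n
∈-vectorsUpTo []       x≤N = here refl
∈-vectorsUpTo (x ∷ xs) x≤N =
  ∈-cartesianProductWith⁺ _∷_ (∈-upTo⁺ (s≤s (x≤N zero))) (∈-vectorsUpTo xs (λ i → x≤N (suc i)))

largest : (f : Fin (suc n) → ℕ) → ∃ λ i → ∀ j → f j ≤ f i
largest f = argmax f zero (allFin _) , λ j →
  All.lookup (f[xs]≤f[argmax] {f = f} zero (allFin _)) (∈-allFin j)

-- Deleting a coordinate, positivity, and updates.

lookup-removeAt : (x : Vec A (suc n)) (i : Fin (suc n)) (j : Fin n) →
                  lookup (removeAt x i) j ≡ lookup x (punchIn i j)
lookup-removeAt (x ∷ xs)         zero    j       = refl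
lookup-removeAt (x ∷ xs@(_ ∷ _)) (suc i) zero    = refl
lookup-removeAt (x ∷ xs@(_ ∷ _)) (suc i) (suc j) = lookup-removeAt xs i j

cover-removeAt : (P : Pred A ℓ′) (x : Vec A (suc n)) (i : Fin (suc n)) → P (lookup x i) →
                 (∀ j → P (lookup (removeAt x i) j)) → ∀ j → P (lookup x j)
cover-removeAt P x i pᵢ pₓ j with i ≟ᶠ j
... | yes refl = pᵢ
... | no i≢j   = subst P (removeAt-punchOut x i≢j) (pₓ (punchOut i≢j))

positive-removeAt : (x : Vec ℕ (suc n)) (i : Fin (suc n)) → Positive x → Positive (removeAt x i)
positive-removeAt x i x⁺ j = subst (0 <_) (sym (lookup-removeAt x i j)) (x⁺ (punchIn i j))

term≤-removeAt : ∀ {c} (a x : Vec ℕ (suc n)) (i : Fin (suc n)) →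
                 (∀ j → lookup a j * lookup x j ^ 2 ≤ c) →
                 ∀ j → lookup (removeAt a i) j * lookup (removeAt x i) j ^ 2 ≤ c
term≤-removeAt {c = c} a x i term≤c j =
  subst₂ (λ s t → s * t ^ 2 ≤ c) (sym (lookup-removeAt a i j)) (sym (lookup-removeAt x i j))
         (term≤c (punchIn i j))

product-removeAt : (x : Vec ℕ (suc n)) (i : Fin (suc n)) →
                   product x ≡ lookup x i * product (removeAt x i)
product-removeAt (x ∷ xs)         zero    = refl
product-removeAt (x ∷ xs@(_ ∷ _)) (suc i) =
  trans (cong (x *_) (product-removeAt xs i)) (swap x (lookup xs i) _)
  where
  swap : ∀ p q r → p * (q * r) ≡ q * (p * r)
  swap = solve-∀

weightedSquares-removeAt : (a x : Vec ℕ (suc n)) (i : Fin (suc n)) →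
  weightedSquares a x ≡
  lookup a i * lookup x i ^ 2 + weightedSquares (removeAt a i) (removeAt x i)
weightedSquares-removeAt (a ∷ as) (x ∷ xs) zero = refl
weightedSquares-removeAt (a ∷ as@(_ ∷ _)) (x ∷ xs@(_ ∷ _)) (suc i) =
  trans (cong (a * x ^ 2 +_) (weightedSquares-removeAt as xs i))
        (swap (a * x ^ 2) (lookup as i * lookup xs i ^ 2) _)
  where
  swap : ∀ p q r → p + (q + r) ≡ q + (p + r)
  swap = solve-∀

weightedSquares-≤ : ∀ {c} (a x : Vec ℕ n) → (∀ i → lookup a i * lookup x i ^ 2 ≤ c) →
                    weightedSquares a x ≤ n * c
weightedSquares-≤ []       []       term≤c = z≤n
weightedSquares-≤ (a ∷ as) (x ∷ xs) term≤c =
  +-mono-≤ (term≤c zero) (weightedSquares-≤ as xs (λ i → term≤c (suc i)))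

*-positive : ∀ {p q} → 0 < p → 0 < q → 0 < p * q
*-positive = *-mono-≤

term-positive : ∀ {p q} → 0 < p → 0 < q → 0 < p * q ^ 2
term-positive 0<p 0<q = *-positive 0<p (*-positive 0<q (*-positive 0<q z<s))

weightedSquares-positive : (a x : Vec ℕ (suc n)) → Positive a → Positive x →
                           0 < weightedSquares a x
weightedSquares-positive (a ∷ as) (x ∷ xs) a⁺ x⁺ =
  ≤-trans (term-positive (a⁺ zero) (x⁺ zero)) (m≤m+n _ _)

product-positive : (x : Vec ℕ n) → Positive x → 0 < product x
product-positive []       x⁺ = z<s
product-positive (x ∷ xs) x⁺ =
  *-positive (x⁺ zero) (product-positive xs (λ i → x⁺ (suc i)))

lookup≤product : (x : Vec ℕ n) → Positive x → ∀ i → lookup x i ≤ product x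
lookup≤product {n = suc _} x x⁺ i = begin
  lookup x i                            ≤⟨ m≤m*n _ _ {{>-nonZero (product-positive (removeAt x i) (positive-removeAt x i x⁺))}} ⟩
  lookup x i * product (removeAt x i)   ≡⟨ product-removeAt x i ⟨
  product x                             ∎
  where open ≤-Reasoning

-- The additive form avoids the truncated difference of old and new entry.
height-update : (x : Vec ℕ n) (i : Fin n) (y : ℕ) →
                height (x [ i ]≔ y) + lookup x i ≡ height x + y
height-update (x ∷ xs) zero    y = swap y (sum xs) x
  where
  swap : ∀ p q r → p + q + r ≡ r + q + p
  swap = solve-∀
height-update (x ∷ xs) (suc i) y =
  trans (+-assoc x _ _) (trans (cong (x +_) (height-update xs i y)) (sym (+-assoc x _ _)))

-- Products of pairwise coprime divisors.

coprime-∣ : ∀ {a b d} → Coprime a b → a ∣ d → b ∣ d → a * b ∣ d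
coprime-∣ {a} {b} c a∣d (divides q refl) = *-monoˡ-∣ b (coprime-divisor c (subst (a ∣_) (*-comm q b) a∣d))

-- A common divisor of `a` and `b * c` is coprime to `b` because it divides `a`; hence it divides
-- `c`.
coprime-* : ∀ {a b c} → Coprime a b → Coprime a c → Coprime a (b * c)
coprime-* cab cac (k∣a , k∣bc) =
  cac (k∣a , coprime-divisor (λ (l∣k , l∣b) → cab (∣-trans l∣k k∣a , l∣b)) k∣bc)

coprime-product : ∀ {a} (as : Vec ℕ n) → (∀ i → Coprime a (lookup as i)) →
                  Coprime a (product as)
coprime-product {a = a} [] c = Coprimality.sym (Coprimality.1-coprimeTo a)
coprime-product (b ∷ as) c = coprime-* (c zero) (coprime-product as (λ i → c (suc i)))

-- By induction: the head is coprime to the product of the tail, and both divide `d`.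
product-∣ : ∀ {d} (a : Vec ℕ n) → (∀ i → lookup a i ∣ d) →
            (∀ i j → i ≢ j → gcd (lookup a i) (lookup a j) ≡ 1) → product a ∣ d
product-∣ []       a∣d cop = 1∣ _
product-∣ (a ∷ as) a∣d cop =
  coprime-∣ (coprime-product as (λ i → gcd≡1⇒coprime (cop zero (suc i) λ ())))
            (a∣d zero)
            (product-∣ as (λ i → a∣d (suc i)) (λ i j i≢j → cop (suc i) (suc j) λ { refl → i≢j refl }))

-- Decidability of the defining conditions.

admissible? : (a : Vec ℕ n) (d : ℕ) → Dec (Admissible a d)
admissible? a d = map′
  (λ (a⁺ , d⁺ , a∣d , cop) → record { a-positive = a⁺ ; d-positive = d⁺ ; aᵢ∣d = a∣d ; coprime = cop })
  (λ adm → let open Admissible adm in a-positive , d-positive , aᵢ∣d , coprime)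
  (all? (λ i → 0 <? lookup a i) ×-dec 0 <? d ×-dec all? (λ i → lookup a i ∣? d) ×-dec
   all? λ i → all? λ j → ¬? (i ≟ᶠ j) →-dec gcd (lookup a i) (lookup a j) ≟ 1)

solution? : (a : Vec ℕ n) (d : ℕ) → Decidable (Solution a d)
solution? a d x = map′
  (λ (x⁺ , eqn) → record { positive = x⁺ ; equation = eqn })
  (λ sol → let open Solution sol in positive , equation)
  (all? (λ i → 0 <? lookup x i) ×-dec weightedSquares a x ≟ d * product x)

fundamental? : {a : Vec ℕ n} {d : ℕ} (adm : Admissible a d) → Decidable (Fundamental adm)
fundamental? {a = a} {d} adm x = map′
  (λ (sol , min) → record { solution = sol ; minimal = min })
  (λ fun → let open Fundamental fun in solution , minimal)
  (solution? a d x ×-dec all? (λ i → height x ≤? height (ψ adm i x)))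

-- Descent on the height and the consequence of minimality.

solution⇒fundamental : {a : Vec ℕ n} {d : ℕ} (adm : Admissible a d) → 2 ≤ n →
                       ∃ (Solution a d) → ∃ (Fundamental adm)
solution⇒fundamental {a = a} {d} adm 2≤n (x , sol) = descend x sol (<-wellFounded (height x))
  where
  descend : ∀ x → Solution a d x → Acc _<_ (height x) → ∃ (Fundamental adm)
  descend x sol (acc rec) with any? (λ i → height (ψ adm i x) <? height x)
  ... | yes (i , lower) = descend (ψ adm i x) (ψ-solution adm sol 2≤n i) (rec lower)
  ... | no ¬lower       = x , record
    { solution = sol ; minimal = λ i → ≮⇒≥ (λ lower → ¬lower (i , lower)) }

-- Minimality gives `z + z ≤ Q`. Multiplied by `b * z`, the right side becomes `d * product x`, the
-- whole weighted sum, and one copy of the term cancels.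
fundamental-half : {a : Vec ℕ (suc n)} {d : ℕ} (adm : Admissible a d) → 2 ≤ suc n →
  {x : Vec ℕ (suc n)} → Fundamental adm x → ∀ i →
  lookup a i * lookup x i ^ 2 ≤ weightedSquares (removeAt a i) (removeAt x i)
fundamental-half {a = a} {d} adm 2≤n {x} fun i = +-cancelˡ-≤ (b * z ^ 2) _ _ (begin
  b * z ^ 2 + b * z ^ 2               ≡⟨ double b z ⟩
  b * z * (z + z)                     ≤⟨ *-monoʳ-≤ (b * z) 2z≤Q ⟩
  b * z * (q * productExcept x i)     ≡⟨ shuffle q b z (productExcept x i) ⟩
  q * b * (z * productExcept x i)     ≡⟨ cong₂ _*_ (_∣_.equality (aᵢ∣d i)) (product-removeAt x i) ⟨
  d * product x                       ≡⟨ equation ⟨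
  weightedSquares a x                 ≡⟨ weightedSquares-removeAt a x i ⟩
  b * z ^ 2 + weightedSquares (removeAt a i) (removeAt x i) ∎)
  where
  open Admissible adm
  open Fundamental fun
  open Solution solution
  open ≤-Reasoning
  b = lookup a i
  z = lookup x i
  q = quotient (aᵢ∣d i)
  Q = q * productExcept x i

  -- Only coordinate `i` changes, so comparing heights compares `z` with its replacement.
  z≤ : z ≤ Q ∸ z
  z≤ = +-cancelˡ-≤ (height x) _ _ (begin
    height x + z                  ≤⟨ +-monoˡ-≤ z (minimal i) ⟩
    height (ψ adm i x) + z        ≡⟨ height-update x i (Q ∸ z) ⟩
    height x + (Q ∸ z)            ∎)

  2z≤Q : z + z ≤ Q
  2z≤Q = begin
    z + z         ≤⟨ +-monoˡ-≤ z z≤ ⟩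
    (Q ∸ z) + z   ≡⟨ m∸n+n≡m (<⇒≤ (ψ-untruncated adm solution 2≤n i)) ⟩
    Q             ∎

  double : ∀ b z → b * (z * (z * 1)) + b * (z * (z * 1)) ≡ b * z * (z + z)
  double = solve-∀

  shuffle : ∀ q b z p → b * z * (q * p) ≡ q * b * (z * p)
  shuffle = solve-∀

-- A priori bounds for fundamental solutions.

coefficientBound : ℕ → ℕ
coefficientBound r = 2 * (1 + r) * (2 + r)

coefficient-≤ : ∀ {a b d e u v A W X r} →
  0 < a → 0 < b → 0 < d → 0 < u → 0 < v →
  d ≡ e * (b * (a * A)) →
  b * v ^ 2 + (a * u ^ 2 + W) ≡ d * (v * (u * X)) →
  b * v ^ 2 ≤ a * u ^ 2 + W → a * u ^ 2 ≤ b * v ^ 2 → W ≤ r * (a * u ^ 2) →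
  d * X ≤ coefficientBound r
-- For `X = 0` the left side vanishes; the other clause needs `X` nonzero to drop `e * A * X`.
coefficient-≤ {d = d} {X = zero} _ _ _ _ _ _ _ _ _ _ = ≤-trans (≤-reflexive (*-zeroʳ d)) z≤n
coefficient-≤ {a} {b} {d} {e} {u} {v} {A} {W} {X@(suc _)} {r} 0<a 0<b 0<d 0<u 0<v d≡ eqn q≤p+W p≤q W≤rp =
  ≤-trans (m≤m*n (d * X) (e * A * X) {{eAX≢0}})
          (*-cancelʳ-≤ _ _ (p * q) {{>-nonZero (*-positive (term-positive 0<a 0<u) (term-positive 0<b 0<v))}} (begin
    d * X * (e * A * X) * (p * q)                           ≡⟨ regroup a b d e u v A X ⟩
    d * (v * (u * X)) * (e * (b * (a * A)) * (v * (u * X))) ≡⟨ cong (λ t → d * (v * (u * X)) * (t * (v * (u * X)))) d≡ ⟨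
    d * (v * (u * X)) * (d * (v * (u * X)))                 ≡⟨ cong (λ t → t * t) eqn ⟨
    S * S                                                   ≤⟨ *-mono-≤ S≤p S≤q ⟩
    2 * ((1 + r) * p) * ((2 + r) * q)                       ≡⟨ collect r p q ⟩
    coefficientBound r * (p * q)                            ∎))
  where
  open ≤-Reasoning
  p = a * u ^ 2
  q = b * v ^ 2
  S = q + (p + W)

  -- Positivity of `d` excludes `e = 0` and `A = 0`.
  eA≢0 : ∀ e A → 0 < e * (b * (a * A)) → NonZero (e * A)
  eA≢0 (suc e) (suc A) _ = _
  eA≢0 (suc e) zero    0<  = case subst (0 <_) (zeros (suc e) a b) 0< of λ ()
    where
    zeros : ∀ e a b → e * (b * (a * 0)) ≡ 0
    zeros = solve-∀

  eAX≢0 : NonZero (e * A * X)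
  eAX≢0 = m*n≢0 (e * A) X {{eA≢0 e A (subst (0 <_) d≡ 0<d)}}

  S≤p : S ≤ 2 * ((1 + r) * p)
  S≤p = begin
    q + (p + W)                     ≤⟨ +-monoˡ-≤ (p + W) q≤p+W ⟩
    (p + W) + (p + W)               ≤⟨ +-mono-≤ (+-monoʳ-≤ p W≤rp) (+-monoʳ-≤ p W≤rp) ⟩
    (p + r * p) + (p + r * p)       ≡⟨ cong ((p + r * p) +_) (+-identityʳ _) ⟨
    2 * ((1 + r) * p)               ∎

  S≤q : S ≤ (2 + r) * q
  S≤q = +-monoʳ-≤ q (+-mono-≤ p≤q (≤-trans W≤rp (*-monoʳ-≤ r p≤q)))

  regroup : ∀ a b d e u v A X →
    d * X * (e * A * X) * (a * (u * (u * 1)) * (b * (v * (v * 1)))) ≡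
    d * (v * (u * X)) * (e * (b * (a * A)) * (v * (u * X)))
  regroup = solve-∀

  collect : ∀ r p q → 2 * ((1 + r) * p) * ((2 + r) * q) ≡ 2 * (1 + r) * (2 + r) * (p * q)
  collect = solve-∀

-- Here p = a u², q = b v², c = a b, and the equation p + q + W = K u v is squared and multiplied
-- by c.  By AM-GM it forces K² > 4 c, so K² p q ≥ 4 c p² + p², while c (p + q + W)² exceeds 4 c p²
-- only by a term linear in p.
second-≤ : ∀ {c K p q W} → 0 < p → 0 < q → 0 < W → 0 < c →
  c * ((p + q + W) * (p + q + W)) ≡ K * K * (p * q) → p ≤ q → q ≤ p + W →
  p ≤ c * (8 * W + 4 * (W * W))
second-≤ {c} {K} {p} {q} {W} 0<p 0<q 0<W 0<c eqn p≤q q≤p+W =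
  *-cancelʳ-≤ _ _ p {{>-nonZero 0<p}} (begin
    p * p                                       ≤⟨ +-cancelˡ-≤ (4 * c * (p * p)) _ _ main ⟩
    -- The constant term is inflated by `p ≥ 1`, so that a factor `p` can be cancelled.
    c * (8 * W * p + 4 * (W * W))               ≤⟨ *-monoʳ-≤ c (+-monoʳ-≤ (8 * W * p) (m≤m*n _ p {{>-nonZero 0<p}})) ⟩
    c * (8 * W * p + 4 * (W * W) * p)           ≡⟨ factor c W p ⟩
    c * (8 * W + 4 * (W * W)) * p               ∎)
  where
  open ≤-Reasoning

  4pq≤ : ∀ {p q} → p ≤ q → 4 * (p * q) ≤ (p + q) * (p + q)
  -- With `q = p + t` the two sides differ by `t * t`.
  4pq≤ {p} {q} p≤q = subst (λ q → 4 * (p * q) ≤ (p + q) * (p + q)) (m+[n∸m]≡n p≤q)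
    (≤-trans (m≤m+n _ ((q ∸ p) * (q ∸ p))) (≤-reflexive (amgm p (q ∸ p))))
    where
    amgm : ∀ p t → 4 * (p * (p + t)) + t * t ≡ (p + (p + t)) * (p + (p + t))
    amgm = solve-∀

  assoc₄ : ∀ c p q → c * (4 * (p * q)) ≡ 4 * c * (p * q)
  assoc₄ = solve-∀

  4c<K² : 4 * c < K * K
  4c<K² = *-cancelʳ-< (p * q) _ _ (begin-strict
    4 * c * (p * q)                   ≡⟨ assoc₄ c p q ⟨
    c * (4 * (p * q))                 ≤⟨ *-monoʳ-≤ c (4pq≤ p≤q) ⟩
    -- Strictness comes from `W > 0`, that is, from the presence of a third term.
    c * ((p + q) * (p + q))           <⟨ *-monoʳ-< c {{>-nonZero 0<c}} (*-mono-< (m<m+n (p + q) 0<W) (m<m+n (p + q) 0<W)) ⟩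
    c * ((p + q + W) * (p + q + W))   ≡⟨ eqn ⟩
    K * K * (p * q)                   ∎)

  p+q+W≤ : p + q + W ≤ p + (p + W) + W
  p+q+W≤ = +-monoˡ-≤ W (+-monoʳ-≤ p q≤p+W)

  expand : ∀ c p W → c * ((p + (p + W) + W) * (p + (p + W) + W)) ≡
                     4 * c * (p * p) + c * (8 * W * p + 4 * (W * W))
  expand = solve-∀

  factor : ∀ c W p → c * (8 * W * p + 4 * (W * W) * p) ≡ c * (8 * W + 4 * (W * W)) * p
  factor = solve-∀

  main : 4 * c * (p * p) + p * p ≤ 4 * c * (p * p) + c * (8 * W * p + 4 * (W * W))
  main = begin
    4 * c * (p * p) + p * p                         ≡⟨ +-comm (4 * c * (p * p)) (p * p) ⟩
    suc (4 * c) * (p * p)                           ≤⟨ *-mono-≤ 4c<K² (*-monoʳ-≤ p p≤q) ⟩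
    K * K * (p * q)                                 ≡⟨ eqn ⟨
    c * ((p + q + W) * (p + q + W))                 ≤⟨ *-monoʳ-≤ c (*-mono-≤ p+q+W≤ p+q+W≤) ⟩
    c * ((p + (p + W) + W) * (p + (p + W) + W))     ≡⟨ expand c p W ⟩
    4 * c * (p * p) + c * (8 * W * p + 4 * (W * W)) ∎

square-≤ : ∀ {b v} → 0 < b → v ≤ b * v ^ 2
square-≤ {b} {zero}    0<b = z≤n
square-≤ {b} {v@(suc _)} 0<b = begin
  v           ≤⟨ m≤m*n v (v * 1) ⟩
  v ^ 2       ≤⟨ m≤n*m (v ^ 2) b {{>-nonZero 0<b}} ⟩
  b * v ^ 2   ∎
  where open ≤-Reasoning

-- `restBound` allows `r` terms with coefficient and coordinate at most `M`. `secondBound` is the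
-- bound of `second-≤` with `c` replaced by `M * M` and `W` by `restBound`. `entryBound` also
-- dominates the largest term, which is at most the second largest plus the rest.
restBound secondBound entryBound : ℕ → ℕ
restBound r = r * (M * M ^ 2) where M = coefficientBound r
secondBound r = M * M * (8 * W + 4 * (W * W))
  where
  M = coefficientBound r
  W = restBound r
entryBound r = coefficientBound r + (secondBound r + restBound r)

fundamental-≤ : ∀ {r} {a : Vec ℕ (3 + r)} {d} (adm : Admissible a d) {x} → Fundamental adm x →
                d ≤ entryBound (suc r) × ∀ i → lookup x i ≤ entryBound (suc r)
fundamental-≤ {r} {a} {d} adm {x} fun =
  ≤-trans d≤M (m≤m+n M _) ,
  cover-removeAt (_≤ N) x m v≤N
    (cover-removeAt (_≤ N) x′ k u≤N (λ j → ≤-trans (x″≤M j) (m≤m+n M _)))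
  where
  open Admissible adm
  open Fundamental fun
  open Solution solution

  -- The number of coordinates left after removing two of `3 + r`; it is at least 1, which makes `W`
  -- positive.
  R = suc r
  M = coefficientBound R
  N = entryBound R

  -- Index `m` carries the largest term `q`; among the others, `k` carries the largest term `p`.
  term-max = largest (λ i → lookup a i * lookup x i ^ 2)
  m = proj₁ term-max
  a′ = removeAt a m
  x′ = removeAt x m
  term′-max = largest (λ j → lookup a′ j * lookup x′ j ^ 2)
  k = proj₁ term′-max
  a″ = removeAt a′ k
  x″ = removeAt x′ k

  b = lookup a m
  v = lookup x m
  c = lookup a′ k
  u = lookup x′ k
  A′ = product a″
  X = product x″
  W = weightedSquares a″ x″
  p = c * u ^ 2
  q = b * v ^ 2

  a′⁺ = positive-removeAt a m a-positive
  x′⁺ = positive-removeAt x m positive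
  a″⁺ = positive-removeAt a′ k a′⁺
  x″⁺ = positive-removeAt x′ k x′⁺

  a∣d : product a ∣ d
  a∣d = product-∣ a aᵢ∣d coprime

  d≡ : d ≡ quotient a∣d * (b * (c * A′))
  d≡ = trans (_∣_.equality a∣d) (cong (quotient a∣d *_)
    (trans (product-removeAt a m) (cong (b *_) (product-removeAt a′ k))))

  split′ : weightedSquares a′ x′ ≡ p + W
  split′ = weightedSquares-removeAt a′ x′ k

  eqn : q + (p + W) ≡ d * (v * (u * X))
  eqn = begin
    q + (p + W)             ≡⟨ cong (q +_) split′ ⟨
    q + weightedSquares a′ x′ ≡⟨ weightedSquares-removeAt a x m ⟨
    weightedSquares a x     ≡⟨ equation ⟩
    d * product x           ≡⟨ cong (d *_) (trans (product-removeAt x m) (cong (v *_) (product-removeAt x′ k))) ⟩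
    d * (v * (u * X))       ∎
    where open ≡-Reasoning

  q≤p+W : q ≤ p + W
  q≤p+W = subst (q ≤_) split′ (fundamental-half adm (s≤s (s≤s z≤n)) fun m)

  p≤q : p ≤ q
  p≤q = term≤-removeAt a x m (proj₂ term-max) k

  dX≤M : d * X ≤ M
  dX≤M = coefficient-≤ {e = quotient a∣d} {A = A′} (a′⁺ k) (a-positive m) d-positive (x′⁺ k) (positive m) d≡ eqn q≤p+W p≤q
    (weightedSquares-≤ a″ x″ (term≤-removeAt a′ x′ k (proj₂ term′-max)))

  -- As `d` and `X` are positive, the bound on `d * X` bounds each of them, and through `X` every
  -- entry of `x″`.
  d≤M : d ≤ M
  d≤M = ≤-trans (m≤m*n d X {{>-nonZero (product-positive x″ x″⁺)}}) dX≤M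

  X≤M : X ≤ M
  X≤M = ≤-trans (m≤n*m X d {{>-nonZero d-positive}}) dX≤M

  a≤M : ∀ i → lookup a i ≤ M
  a≤M i = ≤-trans (∣⇒≤ {{>-nonZero d-positive}} (aᵢ∣d i)) d≤M

  a′≤M : ∀ j → lookup a′ j ≤ M
  a′≤M j = subst (_≤ M) (sym (lookup-removeAt a m j)) (a≤M (punchIn m j))

  a″≤M : ∀ j → lookup a″ j ≤ M
  a″≤M j = subst (_≤ M) (sym (lookup-removeAt a′ k j)) (a′≤M (punchIn k j))

  x″≤M : ∀ j → lookup x″ j ≤ M
  x″≤M j = ≤-trans (lookup≤product x″ x″⁺ j) X≤M

  W≤ : W ≤ restBound R
  W≤ = weightedSquares-≤ a″ x″ (λ j → *-mono-≤ (a″≤M j) (^-monoˡ-≤ 2 (x″≤M j)))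

  -- The factor `b * c` completes `v * v` and `u * u` to `q` and `p`; the role of `K` is played by
  -- `d * X`.
  squared : b * c * ((p + q + W) * (p + q + W)) ≡ d * X * (d * X) * (p * q)
  squared = begin
    b * c * ((p + q + W) * (p + q + W))                 ≡⟨ cong (λ t → b * c * (t * t)) (reorder p q W) ⟩
    b * c * ((q + (p + W)) * (q + (p + W)))             ≡⟨ cong (λ t → b * c * (t * t)) eqn ⟩
    b * c * (d * (v * (u * X)) * (d * (v * (u * X))))   ≡⟨ regroup b c d u v X ⟩
    d * X * (d * X) * (p * q)                           ∎
    where
    open ≡-Reasoning
    reorder : ∀ p q W → p + q + W ≡ q + (p + W)
    reorder = solve-∀
    regroup : ∀ b c d u v X →
      b * c * (d * (v * (u * X)) * (d * (v * (u * X)))) ≡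
      d * X * (d * X) * (c * (u * (u * 1)) * (b * (v * (v * 1))))
    regroup = solve-∀

  p≤ : p ≤ secondBound R
  p≤ = ≤-trans
    (second-≤ {K = d * X} (term-positive (a′⁺ k) (x′⁺ k)) (term-positive (a-positive m) (positive m))
      (weightedSquares-positive a″ x″ a″⁺ x″⁺) (*-positive (a-positive m) (a′⁺ k)) squared p≤q q≤p+W)
    (*-mono-≤ (*-mono-≤ (a≤M m) (a′≤M k))
      (+-mono-≤ (*-monoʳ-≤ 8 W≤) (*-monoʳ-≤ 4 (*-mono-≤ W≤ W≤))))

  u≤N : u ≤ N
  u≤N = m≤n⇒m≤o+n M (≤-trans (square-≤ (a′⁺ k)) (m≤n⇒m≤n+o _ p≤))

  v≤N : v ≤ N
  v≤N = m≤n⇒m≤o+n M (≤-trans (square-≤ (a-positive m)) (≤-trans q≤p+W (+-mono-≤ p≤ W≤)))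

-- Finiteness of the fundamental solutions and of the solvable equations.

fundamental-finite : ∀ {r} {a : Vec ℕ (3 + r)} {d} (adm : Admissible a d) → IsFinite (Fundamental adm)
fundamental-finite adm =
  finite-filter (fundamental? adm) (vectorsUpTo _ _) (λ x fun → ∈-vectorsUpTo x (proj₂ (fundamental-≤ adm fun)))

-- Arbitrary solutions cannot be searched within a box, but by descent a solution exists exactly
-- when a fundamental one does, and those form a finite list.
solvable? : ∀ {r} → Decidable {A = Vec ℕ (3 + r) × ℕ} (λ (a , d) → Admissible a d × ∃ (Solution a d))
solvable? (a , d) with admissible? a d
... | no ¬adm = no λ (adm , _) → ¬adm adm
... | yes adm = map′
  (λ (x , fun) → adm , x , Fundamental.solution fun)
  (λ (_ , sol) → solution⇒fundamental adm (s≤s (s≤s z≤n)) sol)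
  (finite⇒∃? (fundamental-finite adm))

solvable-finite : ∀ r → IsFinite {A = Vec ℕ (3 + r) × ℕ} (λ (a , d) → Admissible a d × ∃ (Solution a d))
solvable-finite r = finite-filter solvable? (cartesianProduct (vectorsUpTo N (3 + r)) (upTo (suc N))) bounded
  where
  N = entryBound (suc r)

  bounded : ∀ ((a , d) : Vec ℕ (3 + r) × ℕ) → Admissible a d × ∃ (Solution a d) →
            (a , d) ∈ cartesianProduct (vectorsUpTo N (3 + r)) (upTo (suc N))
  bounded (a , d) (adm , sol) =
    -- Each coefficient divides the positive `d`, so the bound on `d` obtained from a fundamental
    -- solution covers the whole tuple.
    ∈-cartesianProduct⁺ (∈-vectorsUpTo a (λ i → ≤-trans (∣⇒≤ {{>-nonZero d-positive}} (aᵢ∣d i)) d≤N))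
                        (∈-upTo⁺ (s≤s d≤N))
    where
    open Admissible adm
    d≤N = proj₁ (fundamental-≤ adm (proj₂ (solution⇒fundamental adm (s≤s (s≤s z≤n)) sol)))

theorem3p11 : (n : ℕ) → 3 ≤ n →
    IsFinite {A = Vec ℕ n × ℕ} (λ (a , d) → Admissible a d × ∃ (Solution a d)) ×
    ((a : Vec ℕ n) (d : ℕ) (adm : Admissible a d) →
    ∃ (Solution a d) → IsFinite (Fundamental adm))
theorem3p11 (suc (suc (suc r))) (s≤s (s≤s (s≤s z≤n))) =
  solvable-finite r , λ a d adm _ → fundamental-finite adm
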